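{- For any isolate-free graph $G$, there exists a graph $H$ with a total coalition partition $\pi$ of $H$ such that $G$ is isomorphic to the total coalition graph $TCG(H,\pi)$.
   Context: All graphs are finite and simple (no loops or multiple edges). A graph is isolate-free if it has no vertex of degree $0$. A set $T\subseteq V$ of vertices of a graph with vertex set $V$ is a total dominating set if every vertex of $V$ is adjacent to at least one vertex of $T$. Two disjoint sets $A,B\subset V$ form a total coalition if neither $A$ nor $B$ is a total dominating set, but $A\cup B$ is. A total coalition partition of a graph is a partition $\Psi=\{C_1,\dots,C_k\}$ of its vertex set into non-empty classes such that for every $i$ there exists $j\neq i$ such that $C_i$ and $C_j$ form a total coalition. Given a graph $H$ and a total coalition partition $\pi$ of $H$ (not necessarily of maximum cardinality), the total coalition graph $TCG(H,\pi)$ has the classes of $\pi$ as vertices, two classes being adjacent if and only if they form a total coalition in $H$. -}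

module Defs where

open import Level using (0ℓ)
open import Data.Nat.Base using (ℕ)
open import Data.Fin.Base using (Fin)
open import Data.Fin.Properties using (all?; any?)
open import Data.Fin.Subset using (Subset; _∈_; _∪_; _∩_; Nonempty; Empty; ∣_∣)
open import Data.Fin.Subset.Properties using (_∈?_; nonempty?; ∪-comm; ∪-idem; ∩-comm)
open import Data.Product.Base using (Σ-syntax; ∃-syntax; _×_; _,_)
open import Data.Vec.Base using (tabulate)
open import Function.Bundles using (_↔_; _⇔_; Inverse)
open import Relation.Binary.Core using (Rel)
open import Relation.Binary.Definitions using (Symmetric; Irreflexive; Decidable)
open import Relation.Binary.PropositionalEquality using (_≡_; _≢_; refl; subst)
open import Relation.Nullary using (¬_; does; ¬?; _×-dec_)
import Relation.Unary as U

-- Finite simple graphs, with vertex set Fin order.  Adjacency is decidable,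
-- as it is for any explicitly given finite graph.

record Graph : Set₁ where
  field
    order  : ℕ
    Adj    : Rel (Fin order) 0ℓ
    adj?   : Decidable Adj
    sym    : Symmetric Adj
    irrefl : Irreflexive _≡_ Adj

  Vertex : Set
  Vertex = Fin order

  neighbourhood : Vertex → Subset order
  neighbourhood v = tabulate (λ u → does (adj? v u))

  degree : Vertex → ℕ
  degree v = ∣ neighbourhood v ∣

  IsolateFree : Set
  IsolateFree = ∀ v → degree v ≢ 0

open Graph using (order; Vertex; Adj; adj?; IsolateFree) public

infix 4 _≅_

_≅_ : Graph → Graph → Set
G ≅ H = Σ[ φ ∈ (Vertex G ↔ Vertex H) ]
  (∀ u v → Adj G u v ⇔ Adj H (Inverse.to φ u) (Inverse.to φ v))

Disjoint : ∀ {n} → Subset n → Subset n → Set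
Disjoint A B = Empty (A ∩ B)

record Partition (n : ℕ) : Set where
  field
    size     : ℕ
    class    : Fin size → Subset n
    nonempty : ∀ i → Nonempty (class i)
    disjoint : ∀ {i j} → i ≢ j → Disjoint (class i) (class j)
    covers   : ∀ v → ∃[ i ] v ∈ class i

module _ (H : Graph) where

  TotalDominating : Subset (order H) → Set
  TotalDominating T = ∀ v → ∃[ u ] (u ∈ T × Adj H v u)

  TotalCoalition : Rel (Subset (order H)) 0ℓ
  TotalCoalition A B =
    Disjoint A B × ¬ TotalDominating A × ¬ TotalDominating B × TotalDominating (A ∪ B)

  record TotalCoalitionPartition : Set where
    field
      partition : Partition (order H)
    open Partition partition public
    field
      coalition : ∀ i → ∃[ j ] (j ≢ i × TotalCoalition (class i) (class j))

  totalDominating? : U.Decidable TotalDominating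
  totalDominating? T = all? λ v → any? λ u → (u ∈? T) ×-dec adj? H v u

  totalCoalition? : Decidable TotalCoalition
  totalCoalition? A B =
    ¬? (nonempty? (A ∩ B)) ×-dec ¬? (totalDominating? A) ×-dec ¬? (totalDominating? B)
      ×-dec totalDominating? (A ∪ B)

  totalCoalition-sym : Symmetric TotalCoalition
  totalCoalition-sym {A} {B} (A∩B=∅ , ¬A , ¬B , A∪B) =
    subst Empty (∩-comm A B) A∩B=∅ , ¬B , ¬A , subst TotalDominating (∪-comm A B) A∪B

  totalCoalition-irrefl : ∀ {A} → ¬ TotalCoalition A A
  totalCoalition-irrefl {A} (_ , ¬A , _ , A∪A) = ¬A (subst TotalDominating (∪-idem A) A∪A)

  -- Classes are represented by their indices; distinct indices name distinct
  -- classes, since the classes are non-empty and pairwise disjoint.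

  TCG : TotalCoalitionPartition → Graph
  TCG π = record
    { order  = size
    ; Adj    = λ i j → TotalCoalition (class i) (class j)
    ; adj?   = λ i j → totalCoalition? (class i) (class j)
    ; sym    = totalCoalition-sym
    ; irrefl = λ { refl → totalCoalition-irrefl }
    }
    where open TotalCoalitionPartition π

{-# OPTIONS --safe #-}
-- A union of classes is totally dominating iff it meets, for every vertex v of H, the set S(v) of
-- classes that meet the neighbourhood of v.  So H realises G as soon as every S(v) is a vertex
-- cover of G and every complement of a pair i, j of non-adjacent vertices (possibly i = j)
-- contains some S(v).  Take the cells (i , j) of an n × n grid as vertices of H and the rows as
-- classes; the diagonal is a clique, and an off-diagonal cell (i , j) is joined to the diagonal
-- cells (k , k) with k ≠ i, except (j , j) when i and j are not adjacent in G.  Then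
-- S(i , j) = V ∖ {i} if i = j or i ~ j, and S(i , j) = V ∖ {i , j} otherwise.
module Submission where

open import Defs
open import Level using (0ℓ)
open import Data.Empty using (⊥-elim)
open import Data.Fin.Base using (Fin; combine; remQuot)
open import Data.Fin.Properties using (_≟_; remQuot-combine)
open import Data.Fin.Subset using (Subset; _∈_; _∪_; Nonempty; ∣_∣)
open import Data.Fin.Subset.Properties
  using (nonempty?; Empty-unique; ∣⊥∣≡0; x∈p∩q⁻; x∈p∪q⁻; x∈p∪q⁺)
open import Data.Nat.Base using (ℕ; _*_)
open import Data.Product.Base using (Σ-syntax; ∃-syntax; _×_; _,_; proj₁)
open import Data.Sum.Base using (_⊎_; inj₁; inj₂; swap)
open import Data.Vec.Base using (tabulate)
open import Data.Vec.Properties using (lookup∘tabulate; []=⇒lookup; lookup⇒[]=)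
open import Function.Base using (_∘_)
open import Function.Bundles using (mk⇔)
open import Function.Construct.Identity using (↔-id)
open import Relation.Binary.Core using (Rel)
open import Relation.Binary.Definitions using (Symmetric; Decidable)
open import Relation.Binary.PropositionalEquality
  using (_≡_; _≢_; refl; sym; trans; cong; subst; ≢-sym)
open import Relation.Nullary
  using (¬_; yes; no; does; ¬?; _×-dec_; _⊎-dec_; _→-dec_)
open import Relation.Nullary.Decidable using (dec-true)
import Relation.Unary as U

∈-tabulate-does⁺ : ∀ {n} {P : U.Pred (Fin n) 0ℓ} (P? : U.Decidable P) {v} →
  P v → v ∈ tabulate (does ∘ P?)
∈-tabulate-does⁺ P? {v} pv =
  lookup⇒[]= v _ (trans (lookup∘tabulate (does ∘ P?) v) (dec-true (P? v) pv))

∈-tabulate-does⁻ : ∀ {n} {P : U.Pred (Fin n) 0ℓ} (P? : U.Decidable P) {v} →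
  v ∈ tabulate (does ∘ P?) → P v
∈-tabulate-does⁻ P? {v} v∈
  with P? v | trans (sym (lookup∘tabulate (does ∘ P?) v)) ([]=⇒lookup v∈)
... | yes pv | _ = pv
... | no  _  | ()

∣p∣≢0⇒Nonempty : ∀ {n} (p : Subset n) → ∣ p ∣ ≢ 0 → Nonempty p
∣p∣≢0⇒Nonempty {n} p ∣p∣≢0 with nonempty? p
... | yes ne = ne
... | no  ¬ne = ⊥-elim (∣p∣≢0 (trans (cong ∣_∣ (Empty-unique ¬ne)) (∣⊥∣≡0 n)))

isolateFree⇒neighbour : (G : Graph) → IsolateFree G → ∀ v → ∃[ u ] Adj G v u
isolateFree⇒neighbour G free v =
  let u , u∈ = ∣p∣≢0⇒Nonempty (Graph.neighbourhood G v) (free v)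
  in u , ∈-tabulate-does⁻ (adj? G v) u∈

module Grid (G : Graph) where

  private
    n : ℕ
    n = order G

  Cell : Set
  Cell = Fin n × Fin n

  -- The implication encodes the single exception `(j , j)`. When `i ≡ j` that exception is the cell
  -- itself, which `CellAdj` excludes anyway, so the diagonal is a clique.
  SeesDiagonal : Rel Cell 0ℓ
  SeesDiagonal (i , j) (k , l) = k ≡ l × (k ≡ j → Adj G i j)

  -- The first clause makes every row independent, and the disjunction symmetrises `SeesDiagonal`.
  CellAdj : Rel Cell 0ℓ
  CellAdj x y = proj₁ x ≢ proj₁ y × (SeesDiagonal x y ⊎ SeesDiagonal y x)

  seesDiagonal? : Decidable SeesDiagonal
  seesDiagonal? (i , j) (k , l) = (k ≟ l) ×-dec ((k ≟ j) →-dec adj? G i j)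

  cellAdj? : Decidable CellAdj
  cellAdj? x y = ¬? (proj₁ x ≟ proj₁ y) ×-dec (seesDiagonal? x y ⊎-dec seesDiagonal? y x)

  cellAdj-sym : Symmetric CellAdj
  cellAdj-sym (i≢k , sees) = ≢-sym i≢k , swap sees

  adj⇒≢ : ∀ {i j} → Adj G i j → i ≢ j
  adj⇒≢ i~j i≡j = Graph.irrefl G i≡j i~j

  -- Row `j` can only be reached through `(j , j)`, the guarded cell: the reverse direction would
  -- put `(i , j)` on the diagonal, so both cells would lie in one row.
  cellAdj⇒adj : ∀ {i j l} → CellAdj (i , j) (j , l) → Adj G i j
  cellAdj⇒adj (_   , inj₁ (_ , i~j)) = i~j refl
  cellAdj⇒adj (i≢j , inj₂ (i≡j , _)) = ⊥-elim (i≢j i≡j)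

  -- A cell `(a , b)` can miss only `(a , a)` and `(b , b)`, and it misses two distinct ones only if
  -- `a` and `b` are non-adjacent, so never both ends of an edge.
  adj⇒diagonalNeighbour : ∀ {i j} → Adj G i j → ∀ x →
    CellAdj x (i , i) ⊎ CellAdj x (j , j)
  adj⇒diagonalNeighbour {i} {j} i~j (a , b) with a ≟ i | a ≟ j | i ≟ b
  ... | yes refl | _        | _        = inj₂ (adj⇒≢ i~j , inj₁ (refl , λ { refl → i~j }))
  ... | no a≢i   | yes refl | _        = inj₁ (a≢i , inj₁ (refl , λ { refl → Graph.sym G i~j }))
  -- Column `i` may block `(i , i)`; it cannot block `(j , j)`, since `i ≢ j`.
  ... | no _     | no a≢j   | yes refl = inj₂ (a≢j , inj₁ (refl , λ j≡i → ⊥-elim (adj⇒≢ i~j (sym j≡i))))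
  ... | no a≢i   | no _     | no i≢b   = inj₁ (a≢i , inj₁ (refl , λ i≡b → ⊥-elim (i≢b i≡b)))

  cell : Fin (n * n) → Cell
  cell = remQuot n

  cell-combine : ∀ i j → cell (combine i j) ≡ (i , j)
  cell-combine = remQuot-combine

  H : Graph
  H = record
    { order  = n * n
    ; Adj    = λ v w → CellAdj (cell v) (cell w)
    ; adj?   = λ v w → cellAdj? (cell v) (cell w)
    ; sym    = cellAdj-sym
    ; irrefl = λ { refl (i≢i , _) → i≢i refl }
    }

  inRow? : ∀ i → U.Decidable (λ v → proj₁ (cell v) ≡ i)
  inRow? i v = proj₁ (cell v) ≟ i

  row : Fin n → Subset (n * n)
  row i = tabulate (does ∘ inRow? i)

  ∈-row⁻ : ∀ {i v} → v ∈ row i → proj₁ (cell v) ≡ i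
  ∈-row⁻ {i} = ∈-tabulate-does⁻ (inRow? i)

  combine∈row : ∀ i j → combine i j ∈ row i
  combine∈row i j = ∈-tabulate-does⁺ (inRow? i) (cong proj₁ (cell-combine i j))

  rows : Partition (n * n)
  rows = record
    { size     = n
    ; class    = row
    ; nonempty = λ i → combine i i , combine∈row i i
    ; disjoint = λ {i} {j} i≢j (v , v∈) →
        let v∈i , v∈j = x∈p∩q⁻ (row i) (row j) v∈
        in i≢j (trans (sym (∈-row⁻ v∈i)) (∈-row⁻ v∈j))
    ; covers   = λ v → proj₁ (cell v) , ∈-tabulate-does⁺ (inRow? _) refl
    }

  row-independent : ∀ {i v w} → v ∈ row i → w ∈ row i → ¬ Adj H v w
  row-independent v∈ w∈ (≢ , _) = ≢ (trans (∈-row⁻ v∈) (sym (∈-row⁻ w∈)))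

  row-notTotalDominating : ∀ i → ¬ TotalDominating H (row i)
  row-notTotalDominating i td =
    let _ , u∈ , v~u = td (combine i i)
    in row-independent (combine∈row i i) u∈ v~u

  adj⇒totalCoalition : ∀ {i j} → Adj G i j → TotalCoalition H (row i) (row j)
  adj⇒totalCoalition {i} {j} i~j =
    Partition.disjoint rows (adj⇒≢ i~j) ,
    row-notTotalDominating i , row-notTotalDominating j , dominates
    where
    dominates : TotalDominating H (row i ∪ row j)
    dominates v with adj⇒diagonalNeighbour i~j (cell v)
    ... | inj₁ v~ii = combine i i , x∈p∪q⁺ (inj₁ (combine∈row i i)) ,
                      subst (CellAdj (cell v)) (sym (cell-combine i i)) v~ii
    ... | inj₂ v~jj = combine j j , x∈p∪q⁺ (inj₂ (combine∈row j j)) ,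
                      subst (CellAdj (cell v)) (sym (cell-combine j j)) v~jj

  totalCoalition⇒adj : ∀ {i j} → TotalCoalition H (row i) (row j) → Adj G i j
  -- Cell `(i , j)` is the test vertex: its own row cannot dominate it, so row `j` must.
  totalCoalition⇒adj {i} {j} (_ , _ , _ , td) with td (combine i j)
  ... | u , u∈ , v~u with x∈p∪q⁻ (row i) (row j) u∈
  ...   | inj₁ u∈i = ⊥-elim (row-independent (combine∈row i j) u∈i v~u)
  ...   | inj₂ u∈j with ∈-row⁻ u∈j
  ...     | refl = cellAdj⇒adj (subst (λ x → CellAdj x (cell u)) (cell-combine i j) v~u)

  rowCoalitions : IsolateFree G → TotalCoalitionPartition H
  rowCoalitions free = record
    { partition = rows
    ; coalition = λ i →
        -- Any neighbour of `i` in `G` supplies a coalition partner for row `i`.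
        let j , i~j = isolateFree⇒neighbour G free i
        in j , ≢-sym (adj⇒≢ i~j) , adj⇒totalCoalition i~j
    }

lemma2p5 : (G : Graph) → IsolateFree G →
    Σ[ H ∈ Graph ] Σ[ π ∈ TotalCoalitionPartition H ] (G ≅ TCG H π)
lemma2p5 G free =
  -- Rows are indexed by the vertices of `G`, so the identity is the isomorphism.
  H , rowCoalitions free , ↔-id _ , λ _ _ → mk⇔ adj⇒totalCoalition totalCoalition⇒adj
  where open Grid G
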